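{- Let $q$ be a prime power and let $n \geq 2$ be an integer. The length of the shortest cycle in the graph $A(n,q)$ containing the point $(0)=(0,0,\dots,0)$ is at least $2n+2$; that is, every cycle of $A(n,q)$ passing through the point $(0)$ has length at least $2n+2$.
   Context: Let $\mathbb{F}_q$ be the finite field of order $q$, $q$ a prime power. For $n \geq 2$ let $P$ and $L$ be two disjoint copies of $\mathbb{F}_q^n$; elements of $P$ are called points and written $(p)=(p_1,\dots,p_n)$, and elements of $L$ are called lines and written $[\ell]=[\ell_1,\dots,\ell_n]$. The point $(0,0,\dots,0)\in P$ is denoted $(0)$. The graph $A(n,q)$ is the simple undirected bipartite graph with vertex set $P \sqcup L$ (parts $P$ and $L$) in which the point $(p)$ is adjacent to the line $[\ell]$ if and only if for all $2 \leq j \leq n$, $$p_j+\ell_j = \begin{cases} p_{j-1}\,\ell_1 & \text{if } j \text{ is even},\\ p_1\,\ell_{j-1} & \text{if } j \text{ is odd}.\end{cases}$$ -}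

module Defs where

open import Algebra.Apartness.Bundles using (HeytingField)
open import Data.Fin.Base using (Fin; zero; suc; toℕ; fromℕ; inject₁)
open import Data.Nat.Base using (ℕ; zero; suc; _≤_; _^_; _+_; parity)
open import Data.Nat.Primality using (Prime)
open import Data.Parity.Base using (Parity; 0ℙ; 1ℙ)
open import Data.Product.Base using (∃-syntax; _×_; _,_)
open import Data.Sum.Base using (inj₁; inj₂)
open import Data.Sum.Relation.Binary.Pointwise using (_⊎ₛ_; inj₁; inj₂)
open import Data.Vec.Functional using (Vector; replicate)
import Data.Vec.Functional.Relation.Binary.Equality.Setoid as VecEq
open import Data.Empty.Polymorphic using (⊥)
open import Data.Unit.Polymorphic using (⊤; tt)
open import Function.Bundles using (Inverse)
open import Function.Definitions using (Injective)
open import Level using (Level) renaming (suc to lsuc; _⊔_ to _⊔ˡ_)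
open import Relation.Binary.Bundles using (Setoid)
open import Relation.Binary.Core using (Rel)
open import Relation.Binary.Definitions using (_Respects₂_; Symmetric; Irreflexive)
open import Relation.Binary.PropositionalEquality.Core using (_≡_)
open import Relation.Binary.PropositionalEquality.Properties using () renaming (setoid to ≡-setoid)
open import Relation.Nullary.Negation.Core using (¬_)

PrimePower : ℕ → Set
PrimePower q = ∃[ p ] ∃[ k ] Prime p × 1 ≤ k × q ≡ p ^ k

-- The field axioms are those of `HeytingField`.  With a finite enumeration
-- of the carrier, equality and invertibility are decidable, so the apartness
-- is just ≉ and this is the ordinary notion of a field with q elements.
record FiniteField (c ℓ₁ ℓ₂ : Level) (q : ℕ) : Set (lsuc (c ⊔ˡ ℓ₁ ⊔ˡ ℓ₂)) where
  field
    heytingField : HeytingField c ℓ₁ ℓ₂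
  open HeytingField heytingField public
  field
    enumeration : Inverse (≡-setoid (Fin q)) setoid

record SimpleGraph (v e a : Level) : Set (lsuc (v ⊔ˡ e ⊔ˡ a)) where
  field
    vertices : Setoid v e
  open Setoid vertices public using (_≈_) renaming (Carrier to Vertex)
  field
    Adj      : Rel Vertex a
    resp     : Adj Respects₂ _≈_
    sym      : Symmetric Adj
    irrefl   : Irreflexive _≈_ Adj

module _ {v e a : Level} (G : SimpleGraph v e a) where
  open SimpleGraph G

  record Cycle : Set (v ⊔ˡ e ⊔ˡ a) where
    field
      length-1 : ℕ

    length : ℕ
    length = suc length-1

    field
      3≤length : 3 ≤ length
      vertex   : Fin length → Vertex
      distinct : Injective _≡_ _≈_ vertex
      step     : (i : Fin length-1) → Adj (vertex (inject₁ i)) (vertex (suc i))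
      close    : Adj (vertex (fromℕ length-1)) (vertex zero)

_PassesThrough_ : ∀ {v e a} {G : SimpleGraph v e a} → Cycle G → SimpleGraph.Vertex G → Set e
_PassesThrough_ {G = G} C x = ∃[ i ] SimpleGraph._≈_ G (Cycle.vertex C i) x

module _ {c ℓ₁ ℓ₂ : Level} {q : ℕ} (F : FiniteField c ℓ₁ ℓ₂ q) where
  private module F = FiniteField F
  open VecEq F.setoid using (_≋_; ≋-setoid)

  incidenceRHS : ∀ {m} → Parity → Vector F.Carrier (suc m) → Vector F.Carrier (suc m) → Fin m → F.Carrier
  incidenceRHS 0ℙ p l i = p (inject₁ i) F.* l zero
  incidenceRHS 1ℙ p l i = p zero F.* l (inject₁ i)

  -- Coordinates are 0-based: x_k is the entry at position k - 1.  An index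
  -- i : Fin m stands for j = 2 + toℕ i, which runs over 2 ≤ j ≤ n for
  -- n = suc m; x_j is at `suc i` and x_{j-1} at `inject₁ i`.
  Incident : ∀ {n} → Vector F.Carrier n → Vector F.Carrier n → Set ℓ₁
  Incident {zero}  p l = ⊤
  Incident {suc m} p l = (i : Fin m) →
    (p (suc i) F.+ l (suc i)) F.≈ incidenceRHS (parity (2 + toℕ i)) p l i

  private
    rhs-cong : ∀ {m} (π : Parity) {p p′ l l′ : Vector F.Carrier (suc m)} →
               p ≋ p′ → l ≋ l′ → ∀ i → incidenceRHS π p l i F.≈ incidenceRHS π p′ l′ i
    rhs-cong 0ℙ p≋ l≋ i = F.*-cong (p≋ (inject₁ i)) (l≋ zero)
    rhs-cong 1ℙ p≋ l≋ i = F.*-cong (p≋ zero) (l≋ (inject₁ i))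

    incident-resp : ∀ {n} {p p′ l l′ : Vector F.Carrier n} →
                    p ≋ p′ → l ≋ l′ → Incident p l → Incident p′ l′
    incident-resp {zero}  p≋ l≋ I   = tt
    incident-resp {suc m} p≋ l≋ I i =
      F.trans (F.+-cong (F.sym (p≋ (suc i))) (F.sym (l≋ (suc i))))
        (F.trans (I i) (rhs-cong (parity (2 + toℕ i)) p≋ l≋ i))

  -- Points are the `inj₁` vertices and lines the `inj₂` vertices.
  A : ℕ → SimpleGraph c (c ⊔ˡ ℓ₁) ℓ₁
  A n = record
    { vertices = V
    ; Adj      = Adj
    ; resp     = (λ {x} {y} {z} → respʳ {x} {y} {z}) , λ {x} {y} {z} → respˡ {x} {y} {z}
    ; sym      = λ {x} {y} → Adj-sym {x} {y}
    ; irrefl   = Adj-irrefl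
    }
    where
    V : Setoid c (c ⊔ˡ ℓ₁)
    V = ≋-setoid n ⊎ₛ ≋-setoid n
    open Setoid V using (_≈_) renaming (Carrier to Vertex; refl to ≈-refl)

    Adj : Rel Vertex ℓ₁
    Adj (inj₁ p) (inj₂ l) = Incident p l
    Adj (inj₂ l) (inj₁ p) = Incident p l
    Adj (inj₁ _) (inj₁ _) = ⊥
    Adj (inj₂ _) (inj₂ _) = ⊥

    resp : ∀ {x x′ y y′} → x ≈ x′ → y ≈ y′ → Adj x y → Adj x′ y′
    resp (inj₁ p≋) (inj₂ l≋) I = incident-resp p≋ l≋ I
    resp (inj₂ l≋) (inj₁ p≋) I = incident-resp p≋ l≋ I

    respʳ : ∀ {x y y′} → y ≈ y′ → Adj x y → Adj x y′
    respʳ {x} y≈ = resp (≈-refl {x}) y≈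

    respˡ : ∀ {y x x′} → x ≈ x′ → Adj x y → Adj x′ y
    respˡ {y} x≈ = resp x≈ (≈-refl {y})

    Adj-sym : ∀ {x y} → Adj x y → Adj y x
    Adj-sym {inj₁ _} {inj₂ _} I = I
    Adj-sym {inj₂ _} {inj₁ _} I = I

    Adj-irrefl : ∀ {x y} → x ≈ y → ¬ Adj x y
    Adj-irrefl (inj₁ _) ()
    Adj-irrefl (inj₂ _) ()

  origin : ∀ n → SimpleGraph.Vertex (A n)
  origin n = inj₁ (replicate n F.0#)

{-# OPTIONS --safe #-}

-- Write v₀ = (0), v₁, v₂, … for the vertices of a walk and c_k for the first
-- coordinate of v_k.  Each incidence equation, read along the walk, is
--   v_{k+1,j} + v_{k,j} = c_k v_{k+1,j-1}   if j ≡ k + 1 (mod 2),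
--   v_{k+1,j} + v_{k,j} = c_{k+1} v_{k,j-1} if j ≡ k     (mod 2).
-- By induction v_{k,j} = 0 for j > k, so v_{k,k} = c_{k-1} v_{k,k-1} and
--   v_{k+1,k} = (c_{k+1} − c_{k-1}) v_{k,k-1}.
-- A neighbour of a given vertex is determined by its first coordinate, so
-- if the walk never backtracks, then v_{k+1,k} ≠ 0 for all 1 ≤ k ≤ n.  A
-- cycle through (0) has even length 2k, and its vertex v_{k+1} is reached
-- from (0) in the other direction after k − 1 steps, whence v_{k+1,k} = 0.
-- This is impossible if k ≤ n.
module Submission where

open import Defs
open import Algebra.Apartness.Bundles using (HeytingCommutativeRing)
open import Algebra.Bundles using (CommutativeRing)
import Algebra.Properties.Ring as RingProperties
open import Data.Fin.Base using (Fin; zero; suc; toℕ; fromℕ; fromℕ<; inject₁)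
open import Data.Fin.Induction using (<-weakInduction)
open import Data.Fin.Properties using (toℕ-injective; toℕ-fromℕ; toℕ-fromℕ<; toℕ-inject₁; toℕ<n)
open import Data.Fin.Relation.Unary.Top using (view; ‵fromℕ; ‵inject₁)
open import Data.List.Base using ([]; _∷_)
open import Data.Nat.Base using (ℕ; zero; suc; _≤_; _+_; _*_; z≤n; s≤s; s≤s⁻¹; parity; NonZero)
open import Data.Nat.DivMod
  using (_%_; _/_; _mod_; m≡m%n+[m/n]*n; [m+kn]%n≡m%n; n%n≡0; m<n⇒m%n≡m; %-distribˡ-+)
open import Data.Nat.Properties
  using (m≤n⇒m≤1+n; ≤∧≢⇒<; _<?_; ≮⇒≥; ≤-reflexive; *-monoʳ-≤; +-suc;
    +-identityʳ; *-identityˡ; suc-injective; *-zeroʳ; module ≤-Reasoning)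
open import Data.Nat.Tactic.RingSolver using (solve)
open import Data.Parity.Base using (Parity; 0ℙ; 1ℙ; _⁻¹)
open import Data.Parity.Properties using (⁻¹-selfInverse; suc-homo-⁻¹) renaming (_≟_ to _≟ℙ_)
open import Data.Product.Base using (∃-syntax; _,_; proj₁)
open import Data.Sum.Base using (inj₁; inj₂; [_,_])
open import Data.Sum.Relation.Binary.Pointwise using (inj₁; inj₂)
open import Data.Vec.Functional using (Vector)
open import Function.Base using (id; _∘_)
open import Level using (Level)
open import Relation.Binary.PropositionalEquality as ≡ using (_≡_; _≢_; refl; cong; subst; module ≡-Reasoning)
import Relation.Binary.Reasoning.Setoid as SetoidReasoning
open import Relation.Nullary.Decidable.Core using (yes; no)
open import Relation.Nullary.Negation.Core using (¬_; contradiction)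

-- Parity and residues.

parity-suc : ∀ k → parity (suc k) ≡ parity k ⁻¹
parity-suc k = ≡.sym (⁻¹-selfInverse (suc-homo-⁻¹ k))

≢⇒≡⁻¹ : ∀ {π ρ} → π ≢ ρ → π ≡ ρ ⁻¹
≢⇒≡⁻¹ {0ℙ} {0ℙ} π≢ρ = contradiction refl π≢ρ
≢⇒≡⁻¹ {0ℙ} {1ℙ} π≢ρ = refl
≢⇒≡⁻¹ {1ℙ} {0ℙ} π≢ρ = refl
≢⇒≡⁻¹ {1ℙ} {1ℙ} π≢ρ = contradiction refl π≢ρ

parity≡0ℙ⇒even : ∀ n → parity n ≡ 0ℙ → ∃[ k ] n ≡ 2 * k
parity≡0ℙ⇒even zero          _    = 0 , refl
parity≡0ℙ⇒even (suc (suc n)) even with parity≡0ℙ⇒even n even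
... | k , refl = suc k , solve (k ∷ [])

toℕ-mod : ∀ t n .{{_ : NonZero n}} → toℕ (t mod n) ≡ t % n
toℕ-mod t n = toℕ-fromℕ< _

%-cong-suc : ∀ t n .{{_ : NonZero n}} → suc t % n ≡ suc (t % n) % n
%-cong-suc t n = begin
  suc t % n                        ≡⟨ cong (λ s → suc s % n) (m≡m%n+[m/n]*n t n) ⟩
  (suc (t % n) + (t / n) * n) % n  ≡⟨ [m+kn]%n≡m%n (suc (t % n)) (t / n) n ⟩
  suc (t % n) % n                  ∎
  where open ≡-Reasoning

-- Cancelling `t` modulo `suc m` would leave 2 ≡ 0. As a cycle has at least three vertices, this
-- rules out backtracking.
2+t%n≢t%n : ∀ t m → 2 ≤ m → (2 + t) % suc m ≢ t % suc m
2+t%n≢t%n t m 2≤m eq = contradiction (≡.trans (≡.sym 2%n≡2) 2%n≡0) λ ()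
  where
  open ≡-Reasoning
  n = suc m

  2%n≡2 : 2 % n ≡ 2
  2%n≡2 = m<n⇒m%n≡m (s≤s 2≤m)

  index : ∀ k → k + t * suc m ≡ m * t + (k + t)
  index k = solve (k ∷ t ∷ m ∷ [])

  -- m t is the additive inverse of t modulo n.
  2%n≡0 : 2 % n ≡ 0
  2%n≡0 = begin
    2 % n                            ≡⟨ [m+kn]%n≡m%n 2 t n ⟨
    (2 + t * n) % n                  ≡⟨ cong (_% n) (index 2) ⟩
    (m * t + (2 + t)) % n            ≡⟨ %-distribˡ-+ (m * t) (2 + t) n ⟩
    ((m * t) % n + (2 + t) % n) % n  ≡⟨ cong (λ r → ((m * t) % n + r) % n) eq ⟩
    ((m * t) % n + t % n) % n        ≡⟨ %-distribˡ-+ (m * t) t n ⟨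
    (m * t + t) % n                  ≡⟨ cong (_% n) (index 0) ⟨
    (0 + t * n) % n                  ≡⟨ [m+kn]%n≡m%n 0 t n ⟩
    0 % n                            ≡⟨⟩
    0                                ∎

-- Cycles as periodic walks.

module _ {v e a : Level} {G : SimpleGraph v e a} (C : Cycle G) where
  open SimpleGraph G
  open Cycle C

  -- Unrolling the cycle over ℕ lets a walk start at any vertex and pass the closing edge like any
  -- other.
  around : ℕ → Vertex
  around t = vertex (t mod length)

  -- Multiples of `length` on both sides express congruence without subtraction in ℕ.
  around-cong : ∀ s t j k → s + j * length ≡ t + k * length → around s ≡ around t
  around-cong s t j k eq = cong vertex (toℕ-injective (begin
    toℕ (s mod length)         ≡⟨ toℕ-mod s length ⟩
    s % length                 ≡⟨ [m+kn]%n≡m%n s j length ⟨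
    (s + j * length) % length  ≡⟨ cong (_% length) eq ⟩
    (t + k * length) % length  ≡⟨ [m+kn]%n≡m%n t k length ⟩
    t % length                 ≡⟨ toℕ-mod t length ⟨
    toℕ (t mod length)         ∎))
    where open ≡-Reasoning

  around-toℕ : ∀ i → around (toℕ i) ≡ vertex i
  around-toℕ i = cong vertex (toℕ-injective
    (≡.trans (toℕ-mod (toℕ i) length) (m<n⇒m%n≡m (toℕ<n i))))

  around-adj : ∀ t → Adj (around t) (around (suc t))
  around-adj t = subst (λ j → Adj (around t) (vertex j))
    (toℕ-injective (≡.sym toℕ-suc)) (adj-next (t mod length))
    where
    next : Fin length → Fin length
    next i = suc (toℕ i) mod length

    toℕ-suc : toℕ (suc t mod length) ≡ toℕ (next (t mod length))
    toℕ-suc = begin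
      toℕ (suc t mod length)             ≡⟨ toℕ-mod (suc t) length ⟩
      suc t % length                     ≡⟨ %-cong-suc t length ⟩
      suc (t % length) % length          ≡⟨ cong (λ r → suc r % length) (toℕ-mod t length) ⟨
      suc (toℕ (t mod length)) % length  ≡⟨ toℕ-mod (suc (toℕ (t mod length))) length ⟨
      toℕ (next (t mod length))          ∎
      where open ≡-Reasoning

    adj-next : ∀ i → Adj (vertex i) (vertex (next i))
    adj-next i with view i
    ... | ‵fromℕ     = subst (λ j → Adj (vertex (fromℕ length-1)) (vertex j)) (toℕ-injective (begin
      0                                    ≡⟨ n%n≡0 length ⟨
      suc length-1 % length                ≡⟨ cong (λ r → suc r % length) (toℕ-fromℕ length-1) ⟨
      suc (toℕ (fromℕ length-1)) % length  ≡⟨ toℕ-mod (suc (toℕ (fromℕ length-1))) length ⟨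
      toℕ (next (fromℕ length-1))          ∎)) close
      where open ≡-Reasoning
    ... | ‵inject₁ k = subst (λ j → Adj (vertex (inject₁ k)) (vertex j)) (toℕ-injective (begin
      suc (toℕ k)                     ≡⟨ m<n⇒m%n≡m (s≤s (toℕ<n k)) ⟨
      suc (toℕ k) % length            ≡⟨ cong (λ r → suc r % length) (toℕ-inject₁ k) ⟨
      suc (toℕ (inject₁ k)) % length  ≡⟨ toℕ-mod (suc (toℕ (inject₁ k))) length ⟨
      toℕ (next (inject₁ k))          ∎)) (step k)
      where open ≡-Reasoning

  around-nonbacktracking : ∀ t → ¬ around (2 + t) ≈ around t
  around-nonbacktracking t eq = 2+t%n≢t%n t length-1 (s≤s⁻¹ 3≤length)
    (≡.trans (≡.sym (toℕ-mod (2 + t) length))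
      (≡.trans (cong toℕ (distinct eq)) (toℕ-mod t length)))

-- Cancellation in the field and neighbours in the graph.

module _ {c ℓ₁ ℓ₂ : Level} {q : ℕ} (F : FiniteField c ℓ₁ ℓ₂ q) where
  private module F = FiniteField F
  open F using (Carrier; _≈_; _-_; 0#; 1#)
    renaming (_+_ to _+ᶠ_; _*_ to _*ᶠ_)
  open SetoidReasoning F.setoid
  open RingProperties (CommutativeRing.ring (HeytingCommutativeRing.commutativeRing F.heytingCommutativeRing))
    using ([y-z]x≈yx-zx; x≈y⇒x∙y⁻¹≈ε; +-cancelʳ)

  -- By tightness it suffices to refute `x # y`. Apartness makes `x - y` invertible, and then (x -
  -- y)z = 0 forces z = 0.
  *-cancelʳ-nonZero : ∀ {x y z} → ¬ z ≈ 0# → x *ᶠ z ≈ y *ᶠ z → x ≈ y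
  *-cancelʳ-nonZero {x} {y} {z} z≉0 xz≈yz = proj₁ (F.tight x y) λ x#y →
    let (w , w[x-y]≈1 , _) = F.#⇒invertible x#y in z≉0 (begin
      z                          ≈⟨ F.*-identityˡ z ⟨
      1# *ᶠ z                    ≈⟨ F.*-congʳ w[x-y]≈1 ⟨
      (w *ᶠ (x - y)) *ᶠ z        ≈⟨ F.*-assoc w (x - y) z ⟩
      w *ᶠ ((x - y) *ᶠ z)        ≈⟨ F.*-congˡ ([y-z]x≈yx-zx z x y) ⟩
      w *ᶠ (x *ᶠ z - y *ᶠ z)     ≈⟨ F.*-congˡ (x≈y⇒x∙y⁻¹≈ε xz≈yz) ⟩
      w *ᶠ 0#                    ≈⟨ F.zeroʳ w ⟩
      0#                         ∎)

  module _ {m : ℕ} where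
    open SimpleGraph (A F (suc m)) using (Vertex; Adj)
      renaming (_≈_ to _≈ᵛ_; sym to Adj-sym)

    -- Sides are coded as parities to be comparable with the parity of an index or of a step number.
    side : Vertex → Parity
    side (inj₁ _) = 0ℙ
    side (inj₂ _) = 1ℙ

    coord : Vertex → Vector Carrier (suc m)
    coord = [ id , id ]

    colour : Vertex → Carrier
    colour v = coord v zero

    side-adj : ∀ {u v} → Adj u v → side v ≡ side u ⁻¹
    side-adj {inj₁ _} {inj₂ _} _ = refl
    side-adj {inj₂ _} {inj₁ _} _ = refl

    side-cong : ∀ {u v} → u ≈ᵛ v → side u ≡ side v
    side-cong (inj₁ _) = refl
    side-cong (inj₂ _) = refl

    coord-cong : ∀ {u v} → u ≈ᵛ v → ∀ i → coord u i ≈ coord v i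
    coord-cong (inj₁ p≋) = p≋
    coord-cong (inj₂ l≋) = l≋

    coord-injective : ∀ {u v} → side u ≡ side v → (∀ i → coord u i ≈ coord v i) → u ≈ᵛ v
    coord-injective {inj₁ _} {inj₁ _} _ u≋v = inj₁ u≋v
    coord-injective {inj₂ _} {inj₂ _} _ u≋v = inj₂ u≋v

    -- Either form of `incidenceRHS` is the colour of one end times the preceding coordinate of the
    -- other, and the parity of the index decides which. Here `parity (2 + toℕ i)` reduces to
    -- `parity (toℕ i)`.
    incidence : ∀ {u v} → Adj u v → ∀ i → parity (toℕ i) ≡ side v →
      coord v (suc i) +ᶠ coord u (suc i) ≈ colour u *ᶠ coord v (inject₁ i)
    incidence {inj₁ p} {inj₂ l} I i eq = F.trans (F.+-comm _ _)
      (subst (λ π → p (suc i) +ᶠ l (suc i) ≈ incidenceRHS F π p l i) eq (I i))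
    incidence {inj₂ l} {inj₁ p} I i eq = F.trans
      (subst (λ π → p (suc i) +ᶠ l (suc i) ≈ incidenceRHS F π p l i) eq (I i))
      (F.*-comm _ _)

    -- Given `u` and the colour, the equations fix the other coordinates one by one: the right side
    -- involves either the colour and `u`, or `u` and the preceding coordinate.
    neighbour-unique : ∀ {u v w} → Adj u v → Adj u w → colour v ≈ colour w → v ≈ᵛ w
    neighbour-unique {u} {v} {w} uv uw cv≈cw = coord-injective
      (≡.trans (side-adj {u} {v} uv) (≡.sym (side-adj {u} {w} uw)))
      (<-weakInduction (λ i → coord v i ≈ coord w i) cv≈cw next)
      where
      next : ∀ i → coord v (inject₁ i) ≈ coord w (inject₁ i) → coord v (suc i) ≈ coord w (suc i)
      next i v≈w with parity (toℕ i) ≟ℙ side u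
      ... | yes same = +-cancelʳ (coord u (suc i)) _ _ (begin
        coord v (suc i) +ᶠ coord u (suc i)  ≈⟨ F.+-comm _ _ ⟩
        coord u (suc i) +ᶠ coord v (suc i)  ≈⟨ incidence {v} {u} (Adj-sym {u} {v} uv) i same ⟩
        colour v *ᶠ coord u (inject₁ i)     ≈⟨ F.*-congʳ cv≈cw ⟩
        colour w *ᶠ coord u (inject₁ i)     ≈⟨ incidence {w} {u} (Adj-sym {u} {w} uw) i same ⟨
        coord u (suc i) +ᶠ coord w (suc i)  ≈⟨ F.+-comm _ _ ⟩
        coord w (suc i) +ᶠ coord u (suc i)  ∎)
      ... | no differ = +-cancelʳ (coord u (suc i)) _ _ (begin
        coord v (suc i) +ᶠ coord u (suc i)  ≈⟨ incidence {u} {v} uv i (opposite {v} uv) ⟩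
        colour u *ᶠ coord v (inject₁ i)     ≈⟨ F.*-congˡ v≈w ⟩
        colour u *ᶠ coord w (inject₁ i)     ≈⟨ incidence {u} {w} uw i (opposite {w} uw) ⟨
        coord w (suc i) +ᶠ coord u (suc i)  ∎)
        where
        opposite : ∀ {x} → Adj u x → parity (toℕ i) ≡ side x
        opposite {x} ux = ≡.trans (≢⇒≡⁻¹ differ) (≡.sym (side-adj {u} {x} ux))

    -- Walks from the origin.

    module Walk (v : ℕ → Vertex) (start : v 0 ≈ᵛ origin F (suc m))
                (adj : ∀ k → Adj (v k) (v (suc k))) where

      side≡parity : ∀ k → side (v k) ≡ parity k
      side≡parity zero = side-cong start
      side≡parity (suc k) = ≡.trans (side-adj {v k} {v (suc k)} (adj k))
        (≡.trans (cong _⁻¹ (side≡parity k)) (≡.sym (parity-suc k)))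

      forward : ∀ k i → parity (toℕ i) ≡ parity (suc k) →
        coord (v (suc k)) (suc i) +ᶠ coord (v k) (suc i) ≈ colour (v k) *ᶠ coord (v (suc k)) (inject₁ i)
      forward k i eq = incidence {v k} {v (suc k)} (adj k) i (≡.trans eq (≡.sym (side≡parity (suc k))))

      backward : ∀ k i → parity (toℕ i) ≡ parity k →
        coord (v (suc k)) (suc i) +ᶠ coord (v k) (suc i) ≈ colour (v (suc k)) *ᶠ coord (v k) (inject₁ i)
      backward k i eq = F.trans (F.+-comm _ _)
        (incidence {v (suc k)} {v k} (Adj-sym {v k} {v (suc k)} (adj k)) i (≡.trans eq (≡.sym (side≡parity k))))

      -- Coordinates are indexed from 0, so `k ≤ toℕ i` means j > k for the
      -- 1-based index j of the header.
      vanishing : ∀ k i → k ≤ toℕ i → coord (v k) i ≈ 0#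
      vanishing zero    i _ = coord-cong {v 0} {origin F (suc m)} start i
      -- The inner induction on the index is needed because `forward` refers to the preceding
      -- coordinate of the same vertex.
      vanishing (suc k) = <-weakInduction (λ i → suc k ≤ toℕ i → coord (v (suc k)) i ≈ 0#) (λ ()) next
        where
        dropTerm : ∀ i {x y z} → k ≤ toℕ i → x +ᶠ coord (v k) (suc i) ≈ y *ᶠ z → z ≈ 0# → x ≈ 0#
        dropTerm i {x} {y} {z} k≤i eq z≈0 = begin
          x                         ≈⟨ F.+-identityʳ x ⟨
          x +ᶠ 0#                   ≈⟨ F.+-congˡ (vanishing k (suc i) (m≤n⇒m≤1+n k≤i)) ⟨
          x +ᶠ coord (v k) (suc i)  ≈⟨ eq ⟩
          y *ᶠ z                    ≈⟨ F.*-congˡ z≈0 ⟩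
          y *ᶠ 0#                   ≈⟨ F.zeroʳ y ⟩
          0#                        ∎

        next : ∀ i → (suc k ≤ toℕ (inject₁ i) → coord (v (suc k)) (inject₁ i) ≈ 0#) →
               suc k ≤ toℕ (suc i) → coord (v (suc k)) (suc i) ≈ 0#
        next i ih (s≤s k≤i) with parity (toℕ i) ≟ℙ parity k
        ... | yes same  = dropTerm i k≤i (backward k i same)
          (vanishing k (inject₁ i) (subst (k ≤_) (≡.sym (toℕ-inject₁ i)) k≤i))
        -- Different parities exclude k = i, so k < i, as the inner hypothesis demands.
        ... | no differ = dropTerm i k≤i (forward k i (≡.trans (≢⇒≡⁻¹ differ) (≡.sym (parity-suc k))))
          (ih (subst (suc k ≤_) (≡.sym (toℕ-inject₁ i))
            (≤∧≢⇒< k≤i λ k≡i → differ (cong parity (≡.sym k≡i)))))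

      nonvanishing : (∀ k → ¬ v (2 + k) ≈ᵛ v k) →
        ∀ k i → toℕ i ≡ k → ¬ coord (v (2 + k)) i ≈ 0#
      nonvanishing nonbacktracking = go
        where
        colour-differs : ∀ k → ¬ colour (v (2 + k)) ≈ colour (v k)
        colour-differs k eq = nonbacktracking k
          (neighbour-unique {v (suc k)} {v (2 + k)} {v k} (adj (suc k)) (Adj-sym {v k} {v (suc k)} (adj k)) eq)

        go : ∀ k i → toℕ i ≡ k → ¬ coord (v (2 + k)) i ≈ 0#
        -- The origin has colour 0, so `v 2` must not.
        go zero    zero    _   x≈0 = colour-differs 0 (F.trans x≈0 (F.sym (vanishing 0 zero z≤n)))
        go (suc k) (suc i) i≡k x≈0 =
          -- `backward` into `v (3 + k)` and `forward` out of `v (suc k)` share a factor that is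
          -- nonzero by induction. Their left sides agree once the two zero terms are dropped, so
          -- cancelling equates colours two steps apart.
          colour-differs (suc k) (*-cancelʳ-nonZero (go k (inject₁ i) i′≡k) (begin
            colour (v (3 + k)) *ᶠ coord (v (2 + k)) (inject₁ i)     ≈⟨ backward (2 + k) i parity≡ ⟨
            coord (v (3 + k)) (suc i) +ᶠ coord (v (2 + k)) (suc i)  ≈⟨ F.+-congʳ x≈0 ⟩
            0# +ᶠ coord (v (2 + k)) (suc i)                         ≈⟨ F.+-comm _ _ ⟩
            coord (v (2 + k)) (suc i) +ᶠ 0#                         ≈⟨ F.+-congˡ (vanishing (suc k) (suc i) 1+k≤1+i) ⟨
            coord (v (2 + k)) (suc i) +ᶠ coord (v (suc k)) (suc i)  ≈⟨ forward (suc k) i parity≡ ⟩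
            colour (v (suc k)) *ᶠ coord (v (2 + k)) (inject₁ i)     ∎))
          where
          i′≡k : toℕ (inject₁ i) ≡ k
          i′≡k = ≡.trans (toℕ-inject₁ i) (suc-injective i≡k)

          1+k≤1+i : suc k ≤ toℕ (suc i)
          1+k≤1+i = ≤-reflexive (≡.sym i≡k)

          -- This serves both equations, as `parity (2 + k)` reduces to `parity k`.
          parity≡ : parity (toℕ i) ≡ parity k
          parity≡ = cong parity (suc-injective i≡k)

-- The two walks round a cycle through the origin.

theorem2p3 : ∀ {c ℓ₁ ℓ₂ : Level} (q : ℕ) → PrimePower q →
    (F : FiniteField c ℓ₁ ℓ₂ q) (n : ℕ) → 2 ≤ n →
    (C : Cycle (A F n)) → C PassesThrough (origin F n) →
    2 * n + 2 ≤ Cycle.length C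
theorem2p3 q _ F (suc m) _ C (a , Ca≈origin) = conclude (parity≡0ℙ⇒even length length-even)
  where
  n = suc m
  open Cycle C
  open SimpleGraph (A F n) using (Vertex; Adj; _≈_) renaming (sym to Adj-sym)

  -- Adding length − 1 modulo the length is a step backwards.
  there back : ℕ → Vertex
  there t = around C (toℕ a + t)
  back t = around C (toℕ a + length-1 * t)

  -- The equation is an argument because `length-1 * 0` does not reduce to 0.
  start : ∀ {t} → t ≡ 0 → around C (toℕ a + t) ≈ origin F n
  start refl = subst (_≈ origin F n)
    (≡.sym (≡.trans (cong (around C) (+-identityʳ (toℕ a))) (around-toℕ C a))) Ca≈origin

  there-adj : ∀ t → Adj (there t) (there (suc t))
  there-adj t = subst (λ s → Adj (there t) (around C s)) (≡.sym (+-suc (toℕ a) t)) (around-adj C (toℕ a + t))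

  back-adj : ∀ t → Adj (back t) (back (suc t))
  -- A forward step from `back (suc t)` ends one full turn past `back t`, whence the multiples 0 and
  -- 1.
  back-adj t = Adj-sym {back (suc t)} {back t} (subst (Adj (back (suc t)))
    (around-cong C (suc (toℕ a + length-1 * suc t)) (toℕ a + length-1 * t) 0 1 (index (toℕ a) length-1))
    (around-adj C (toℕ a + length-1 * suc t)))
    where
    index : ∀ a ℓ → suc (a + ℓ * suc t) + 0 ≡ a + ℓ * t + 1 * suc ℓ
    index a ℓ = solve (a ∷ ℓ ∷ t ∷ [])

  there-nonbacktracking : ∀ t → ¬ there (2 + t) ≈ there t
  there-nonbacktracking t = around-nonbacktracking C (toℕ a + t) ∘ subst (_≈ there t) (cong (around C) (index (toℕ a)))
    where
    index : ∀ a → a + (2 + t) ≡ 2 + (a + t)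
    index a = solve (a ∷ t ∷ [])

  module There = Walk F there (start refl) there-adj
  module Back  = Walk F back (start (*-zeroʳ length-1)) back-adj

  length-even : parity length ≡ 0ℙ
  length-even = begin
    parity length          ≡⟨ There.side≡parity length ⟨
    side F (there length)  ≡⟨ cong (side F) (around-cong C (toℕ a + length) (toℕ a + 0) 0 1 (index (toℕ a) length)) ⟩
    side F (there 0)       ≡⟨ There.side≡parity 0 ⟩
    0ℙ                     ∎
    where
    open ≡-Reasoning

    index : ∀ a l → a + l + 0 ≡ a + 0 + 1 * l
    index a l = solve (a ∷ l ∷ [])

  -- Together 2 + h steps forward and h steps back make one full turn. The multiple `h` compensates
  -- for coding each backward step as `length-1` forward ones.
  meet : ∀ h → length ≡ 2 * suc h → there (2 + h) ≡ back h
  meet h length≡ = around-cong C (toℕ a + (2 + h)) (toℕ a + length-1 * h) h 1 (begin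
    toℕ a + (2 + h) + h * length         ≡⟨ index (toℕ a) length-1 ⟩
    toℕ a + length-1 * h + 2 * suc h     ≡⟨ cong (toℕ a + length-1 * h +_) length≡ ⟨
    toℕ a + length-1 * h + length        ≡⟨ cong (toℕ a + length-1 * h +_) (*-identityˡ length) ⟨
    toℕ a + length-1 * h + 1 * length    ∎)
    where
    open ≡-Reasoning

    index : ∀ a ℓ → a + (2 + h) + h * suc ℓ ≡ a + ℓ * h + 2 * suc h
    index a ℓ = solve (a ∷ ℓ ∷ h ∷ [])

  conclude : ∃[ k ] length ≡ 2 * k → 2 * n + 2 ≤ length
  -- The half-length is positive since `length` is a successor. If h < n, the entry at 0-based
  -- position `h` of the meeting vertex is nonzero along `there` but zero along `back`.
  conclude (suc h , length≡) with h <? n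
  ... | yes h<n = contradiction
    (subst (λ v → coord F v i F.≈ F.0#) (≡.sym (meet h length≡)) (Back.vanishing h i (≤-reflexive (≡.sym i≡h))))
    (There.nonvanishing there-nonbacktracking h i i≡h)
    where
    module F = FiniteField F
    i = fromℕ< h<n
    i≡h = toℕ-fromℕ< h<n
  ... | no h≮n = begin
    2 * n + 2  ≡⟨ double n ⟩
    2 * suc n  ≤⟨ *-monoʳ-≤ 2 (s≤s (≮⇒≥ h≮n)) ⟩
    2 * suc h  ≡⟨ length≡ ⟨
    length     ∎
    where
    open ≤-Reasoning

    double : ∀ n → 2 * n + 2 ≡ 2 * suc n
    double n = solve (n ∷ [])
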